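{- Let $\Sigma$ be a signature containing a binary relation symbol $\equiv$. Then $\mathsf{FSATEQ}(\Sigma;\equiv)\preceq\mathsf{FSAT}(\Sigma)$.
   Context: We work in constructive type theory. $p\preceq q$ means there is a function $f$ with $p\,x\leftrightarrow q(f\,x)$ for all $x$. A type is finite if some list contains all of its elements. A signature consists of a type of function symbols and a type of relation symbols, each with an arity. Formulas are first-order formulas built from $\dot\bot$, atoms, $\dot\to,\dot\land,\dot\lor,\dot\forall,\dot\exists$. A model over a domain $D$ interprets function symbols as functions $D^{|f|}\to D$ and relation symbols as predicates $D^{|P|}\to\mathbb P$, with Tarski satisfaction $\mathcal M\vDash_\rho\varphi$. The model is decidable if every relation interpretation is decidable. $\mathsf{FSAT}(\Sigma)\,\varphi$ holds iff some finite type $D$, decidable model over $D$ and assignment $\rho$ satisfy $\varphi$. $\mathsf{FSATEQ}(\Sigma;\equiv)\,\varphi$ holds iff this is possible with the model additionally satisfying $\equiv^{\mathcal M}x\,y\leftrightarrow x=y$ for all $x,y:D$. -}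

module Defs where

open import Level using (Level; _⊔_) renaming (suc to lsuc)
open import Data.Empty.Polymorphic using (⊥)
open import Data.List.Base using (List)
open import Data.List.Membership.Propositional using (_∈_)
open import Data.Nat.Base using (ℕ; zero; suc)
open import Data.Product.Base using (Σ; ∃; _×_)
open import Data.Sum.Base using (_⊎_)
open import Data.Vec.Base using (Vec; []; _∷_)
open import Function.Bundles using (_⇔_)
open import Relation.Binary.PropositionalEquality.Core using (_≡_; sym; subst)
open import Relation.Unary using (Pred; Decidable)

private
  variable
    a b p q f r ℓ : Level

infix 4 _⪯_

_⪯_ : {A : Set a} {B : Set b} → Pred A p → Pred B q → Set (a ⊔ b ⊔ p ⊔ q)
_⪯_ {A = A} {B = B} P Q = Σ (A → B) λ g → ∀ x → P x ⇔ Q (g x)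

Finite : Set a → Set a
Finite A = Σ (List A) λ xs → ∀ x → x ∈ xs

record Signature (f r : Level) : Set (lsuc (f ⊔ r)) where
  field
    Fun   : Set f
    Rel   : Set r
    funAr : Fun → ℕ
    relAr : Rel → ℕ

open Signature public

data Term (S : Signature f r) : Set f where
  var : ℕ → Term S
  app : (g : Fun S) → Vec (Term S) (funAr S g) → Term S

infixr 7 _∧̇_
infixr 6 _∨̇_
infixr 5 _→̇_

-- Variables are de Bruijn indices: ∀̇ and ∃̇ bind index 0 of their body.
data Form (S : Signature f r) : Set (f ⊔ r) where
  ⊥̇             : Form S
  atom           : (P : Rel S) → Vec (Term S) (relAr S P) → Form S
  _→̇_ _∧̇_ _∨̇_ : Form S → Form S → Form S
  ∀̇_ ∃̇_        : Form S → Form S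

record Model (S : Signature f r) (D : Set ℓ) : Set (f ⊔ r ⊔ lsuc ℓ) where
  field
    funᴹ : (g : Fun S) → Vec D (funAr S g) → D
    relᴹ : (P : Rel S) → Pred (Vec D (relAr S P)) ℓ

infixr 5 _•_

_•_ : {D : Set ℓ} → D → (ℕ → D) → (ℕ → D)
(d • ρ) zero    = d
(d • ρ) (suc n) = ρ n

module _ {S : Signature f r} {D : Set ℓ} (M : Model S D) where

  open Model M

  eval  : (ℕ → D) → Term S → D
  evals : (ℕ → D) → ∀ {n} → Vec (Term S) n → Vec D n

  eval ρ (var n)    = ρ n
  eval ρ (app g ts) = funᴹ g (evals ρ ts)

  evals ρ []       = []
  evals ρ (t ∷ ts) = eval ρ t ∷ evals ρ ts

  infix 4 _⊨_

  _⊨_ : (ℕ → D) → Form S → Set ℓ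
  ρ ⊨ ⊥̇         = ⊥
  ρ ⊨ atom P ts  = relᴹ P (evals ρ ts)
  ρ ⊨ (φ →̇ ψ)  = ρ ⊨ φ → ρ ⊨ ψ
  ρ ⊨ (φ ∧̇ ψ)  = ρ ⊨ φ × ρ ⊨ ψ
  ρ ⊨ (φ ∨̇ ψ)  = ρ ⊨ φ ⊎ ρ ⊨ ψ
  ρ ⊨ (∀̇ φ)     = ∀ d → (d • ρ) ⊨ φ
  ρ ⊨ (∃̇ φ)     = ∃ λ d → (d • ρ) ⊨ φ

  DecidableModel : Set (r ⊔ ℓ)
  DecidableModel = ∀ P → Decidable (relᴹ P)

  InterpretsAsEquality : (E : Rel S) → relAr S E ≡ 2 → Set ℓ
  InterpretsAsEquality E ar =
    ∀ x y → relᴹ E (subst (Vec D) (sym ar) (x ∷ y ∷ [])) ⇔ x ≡ y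

-- ℓ is the universe of the domains and of the propositions interpreting the
-- relation symbols.
FSAT : (ℓ : Level) (S : Signature f r) → Pred (Form S) (f ⊔ r ⊔ lsuc ℓ)
FSAT ℓ S φ =
  Σ (Set ℓ) λ D → Σ (Model S D) λ M → Σ (ℕ → D) λ ρ →
    Finite D × DecidableModel M × _⊨_ M ρ φ

FSATEQ : (ℓ : Level) (S : Signature f r) (E : Rel S) → relAr S E ≡ 2 →
         Pred (Form S) (f ⊔ r ⊔ lsuc ℓ)
FSATEQ ℓ S E ar φ =
  Σ (Set ℓ) λ D → Σ (Model S D) λ M → Σ (ℕ → D) λ ρ →
    Finite D × DecidableModel M × InterpretsAsEquality M E ar × _⊨_ M ρ φ

{-# OPTIONS --safe #-}

-- φ has a finite decidable model with true equality iff φ ∧ "E is an equivalence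
-- relation and a congruence for every symbol occurring in φ" has a finite
-- decidable model.  For the converse implication, such a model is quotiented by
-- E: listing the domain and removing E-duplicates leaves exactly one
-- representative per class, so the positions in this list form the new domain, on
-- which every symbol is interpreted through the representatives.  Symbols not
-- occurring in φ need not respect E, but their interpretation does not matter.

module Submission where

open import Defs
open import Data.Empty.Polymorphic using (⊥-elim)
open import Data.Fin.Base using (Fin; zero; suc)
open import Data.List.Base as List using (List; _∷_; length; deduplicate)
open import Data.List.Membership.Propositional.Properties using (∈-allFin; ∈-lookup; ∈-map⁺)
open import Data.List.Relation.Unary.All as All using (All)
open import Data.List.Relation.Unary.AllPairs using (AllPairs; _∷_)
open import Data.List.Relation.Unary.Any as Any using (index)
open import Data.List.Relation.Unary.Any.Properties using (lookup-index)
open import Data.List.Relation.Unary.Enumerates.Setoid.Properties using (deduplicate⁺)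
open import Data.List.Relation.Unary.Unique.DecSetoid.Properties using (deduplicate-!)
open import Data.Nat.Base using (ℕ; zero; suc; _+_)
open import Data.Product.Base using (_,_)
open import Data.Product.Function.NonDependent.Propositional using (_×-⇔_)
open import Data.Sum.Function.Propositional using (_⊎-⇔_)
open import Data.Vec.Base using (Vec; []; _∷_; map)
open import Data.Vec.Relation.Binary.Pointwise.Inductive as Pointwise
  using (Pointwise; []; _∷_; Pointwise-≡⇒≡)
open import Function.Base using (id; _∘_)
open import Function.Bundles using (_⇔_; mk⇔; Equivalence)
open import Function.Related.TypeIsomorphisms using (→-cong-⇔)
open import Level using (Level; Lift; _⊔_; lift; lower)
open import Relation.Binary.Bundles using (DecSetoid)
open import Relation.Binary.Core using () renaming (Rel to BinRel)
open import Relation.Binary.Definitions using (Reflexive; Symmetric; Transitive)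
open import Relation.Binary.PropositionalEquality
  using (_≡_; refl; sym; trans; cong; cong₂; subst)
open import Relation.Nullary.Negation using (¬_; contradiction)

open Equivalence using (to; from)

private
  variable
    a f r ℓ : Level
    A : Set a
    n : ℕ

-- Representatives of a decidable equivalence on a finite type

-- `AllPairs` compares an earlier entry with a later one only; symmetry settles positions given in
-- the opposite order.
lookup-injective : {_≈_ : BinRel A ℓ} → Symmetric _≈_ →
                   {xs : List A} → AllPairs (λ x y → ¬ x ≈ y) xs →
                   ∀ i j → List.lookup xs i ≈ List.lookup xs j → i ≡ j
lookup-injective ≈-sym (_ ∷ _) zero zero _ = refl
lookup-injective ≈-sym {_ ∷ xs} (x≉ ∷ _) zero (suc j) x≈y =
  contradiction x≈y (All.lookup x≉ (∈-lookup {xs = xs} j))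
lookup-injective ≈-sym {_ ∷ xs} (x≉ ∷ _) (suc i) zero y≈x =
  contradiction (≈-sym y≈x) (All.lookup x≉ (∈-lookup {xs = xs} i))
lookup-injective ≈-sym (_ ∷ xs!) (suc i) (suc j) x≈y =
  cong suc (lookup-injective ≈-sym xs! i j x≈y)

-- A finite quotient of `A`: `Fin size` is the set of classes, `class` the projection and `rep` a
-- choice of one element per class.
record Representatives {A : Set a} (_≈_ : BinRel A ℓ) : Set (a ⊔ ℓ) where
  field
    size        : ℕ
    rep         : Fin size → A
    class       : A → Fin size
    rep-class   : ∀ x → x ≈ rep (class x)
    rep-injects : ∀ i j → rep i ≈ rep j → i ≡ j

representatives : (S : DecSetoid a ℓ) → Finite (DecSetoid.Carrier S) →
                  Representatives (DecSetoid._≈_ S)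
representatives S (xs , ∈xs) = record
  { size        = length reps
  ; rep         = List.lookup reps
  ; class       = index ∘ ∈reps
  ; rep-class   = lookup-index ∘ ∈reps
  ; rep-injects = lookup-injective ≈-sym (deduplicate-! S xs)
  }
  where
  open DecSetoid S using (_≟_; reflexive) renaming (sym to ≈-sym)
  reps = deduplicate _≟_ xs
  -- Deduplication may delete `x` itself and keep only an equivalent entry, so membership is first
  -- weakened from `≡` to `≈`.
  ∈reps = deduplicate⁺ S (Any.map reflexive ∘ ∈xs)

-- Blocks of universal quantifiers

prepend : {D : Set ℓ} → Vec D n → (ℕ → D) → (ℕ → D)
prepend []       ρ = ρ
prepend (x ∷ xs) ρ = x • prepend xs ρ

prepend-+ : {D : Set ℓ} (xs : Vec D n) (ρ : ℕ → D) → ∀ m → prepend xs ρ (n + m) ≡ ρ m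
prepend-+ []       ρ m = refl
prepend-+ (x ∷ xs) ρ m = prepend-+ xs ρ m

module _ {S : Signature f r} where

  ⊤̇ : Form S
  ⊤̇ = ⊥̇ →̇ ⊥̇

  -- The added quantifier goes innermost, so index 0 refers to the head of the vector in `prepend`.
  ∀̇^ : ℕ → Form S → Form S
  ∀̇^ zero    φ = φ
  ∀̇^ (suc n) φ = ∀̇^ n (∀̇ φ)

  vars : (ℕ → ℕ) → ∀ n → Vec (Term S) n
  vars s zero    = []
  vars s (suc n) = var (s 0) ∷ vars (s ∘ suc) n

  module _ {D : Set ℓ} (M : Model S D) where

    ⊨-∀̇^ : ∀ n {φ ρ} → _⊨_ M ρ (∀̇^ n φ) ⇔ ((xs : Vec D n) → _⊨_ M (prepend xs ρ) φ)
    ⊨-∀̇^ zero    = mk⇔ (λ { h [] → h }) (λ h → h [])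
    ⊨-∀̇^ (suc n) = mk⇔
      (λ { h (x ∷ xs) → to (⊨-∀̇^ n) h xs x })
      (λ h → from (⊨-∀̇^ n) λ xs x → h (x ∷ xs))

    evals-vars : ∀ {σ τ} s (xs : Vec D n) → (∀ m → σ (s m) ≡ prepend xs τ m) →
                 evals M σ (vars s n) ≡ xs
    evals-vars s []       h = refl
    evals-vars s (x ∷ xs) h = cong₂ _∷_ (h 0) (evals-vars (s ∘ suc) xs (h ∘ suc))

    -- With variables on both sides the equation can be matched with `refl`, which is impossible for
    -- `relAr S E ≡ 2` itself.
    evals-subst : ∀ {m n} (m≡n : m ≡ n) ρ (ts : Vec (Term S) m) →
                  evals M ρ (subst (Vec (Term S)) m≡n ts) ≡ subst (Vec D) m≡n (evals M ρ ts)
    evals-subst refl ρ ts = refl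

-- The equality axioms as formulas

module _ (S : Signature f r) (E : Rel S) (ar : relAr S E ≡ 2) where

  infix 8 _≈̇_

  _≈̇_ : Term S → Term S → Form S
  t ≈̇ u = atom E (subst (Vec (Term S)) (sym ar) (t ∷ u ∷ []))

  chain : Vec (Term S) n → Vec (Term S) n → Form S → Form S
  chain []       []       φ = φ
  chain (t ∷ ts) (u ∷ us) φ = (t ≈̇ u) →̇ chain ts us φ

  -- Under the 2n binders of ∀≈̇ n, the inner block has the indices 0, …, n − 1 and
  -- the outer block the indices n, …, 2n − 1.
  lefts rights : ∀ n → Vec (Term S) n
  lefts  n = vars id n
  rights n = vars (n +_) n

  ∀≈̇ : ℕ → Form S → Form S
  ∀≈̇ n φ = ∀̇^ n (∀̇^ n (chain (lefts n) (rights n) φ))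

  funCongruence : Fun S → Form S
  funCongruence g = ∀≈̇ (funAr S g) (app g (lefts _) ≈̇ app g (rights _))

  -- One implication suffices, as the converse follows from the symmetry of `E`.
  relCongruence : Rel S → Form S
  relCongruence P = ∀≈̇ (relAr S P) (atom P (lefts _) →̇ atom P (rights _))

  -- Collecting axioms along the syntax keeps the conjunction finite even over an infinite
  -- signature.
  congruenceᵗ  : Term S → Form S
  congruenceᵗˢ : Vec (Term S) n → Form S

  congruenceᵗ (var _)    = ⊤̇
  congruenceᵗ (app g ts) = funCongruence g ∧̇ congruenceᵗˢ ts

  congruenceᵗˢ []       = ⊤̇
  congruenceᵗˢ (t ∷ ts) = congruenceᵗ t ∧̇ congruenceᵗˢ ts

  congruence : Form S → Form S
  congruence ⊥̇           = ⊤̇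
  congruence (atom P ts) = relCongruence P ∧̇ congruenceᵗˢ ts
  congruence (φ →̇ ψ)     = congruence φ ∧̇ congruence ψ
  congruence (φ ∧̇ ψ)     = congruence φ ∧̇ congruence ψ
  congruence (φ ∨̇ ψ)     = congruence φ ∧̇ congruence ψ
  -- The axioms collected from the body are closed, so they may leave the scope of the binder.
  congruence (∀̇ φ)       = congruence φ
  congruence (∃̇ φ)       = congruence φ

  reflexivity : Form S
  reflexivity = ∀̇ (var 0 ≈̇ var 0)

  -- Together with reflexivity, this yields symmetry and transitivity.
  euclideanness : Form S
  euclideanness = ∀̇ ∀̇ ∀̇ (var 2 ≈̇ var 1 →̇ var 2 ≈̇ var 0 →̇ var 1 ≈̇ var 0)

  equalityFree : Form S → Form S
  equalityFree φ = φ ∧̇ reflexivity ∧̇ euclideanness ∧̇ congruence φ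

  -- Meaning of the axioms in a model

  module _ {D : Set ℓ} (M : Model S D) where

    open Model M

    _≈_ : BinRel D ℓ
    x ≈ y = relᴹ E (subst (Vec D) (sym ar) (x ∷ y ∷ []))

    ⊨-≈̇ : ∀ {ρ} t u → _⊨_ M ρ (t ≈̇ u) ≡ (eval M ρ t ≈ eval M ρ u)
    ⊨-≈̇ t u = cong (relᴹ E) (evals-subst M (sym ar) _ (t ∷ u ∷ []))

    ⊨-chain : ∀ {ρ φ} (ts us : Vec (Term S) n) →
              _⊨_ M ρ (chain ts us φ) ⇔
              (Pointwise _≈_ (evals M ρ ts) (evals M ρ us) → _⊨_ M ρ φ)
    ⊨-chain []       []       = mk⇔ (λ { h [] → h }) (λ h → h [])
    ⊨-chain (t ∷ ts) (u ∷ us) = mk⇔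
      (λ { h (t≈u ∷ ts≈us) → to (⊨-chain ts us) (h (subst id (sym (⊨-≈̇ t u)) t≈u)) ts≈us })
      (λ h t≈u → from (⊨-chain ts us) λ ts≈us → h (subst id (⊨-≈̇ t u) t≈u ∷ ts≈us))

    evals-lefts : ∀ {ρ} (xs ys : Vec D n) → evals M (prepend xs (prepend ys ρ)) (lefts n) ≡ xs
    evals-lefts xs ys = evals-vars M id xs λ _ → refl

    evals-rights : ∀ {ρ} (xs ys : Vec D n) → evals M (prepend xs (prepend ys ρ)) (rights n) ≡ ys
    evals-rights xs ys = evals-vars M _ ys (prepend-+ xs _)

    ⊨-∀≈̇ : ∀ n {ρ φ} → _⊨_ M ρ (∀≈̇ n φ) ⇔
           (∀ (xs ys : Vec D n) → Pointwise _≈_ xs ys → _⊨_ M (prepend xs (prepend ys ρ)) φ)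
    ⊨-∀≈̇ n {ρ} {φ} = mk⇔
      (λ h xs ys xs≈ys →
        -- The outer block of quantifiers receives `ys`, the inner block `xs`.
        to (⊨-chain (lefts n) (rights n)) (to (⊨-∀̇^ M n) (to (⊨-∀̇^ M n) h ys) xs)
          (subst id (sym (eq xs ys)) xs≈ys))
      (λ h → from (⊨-∀̇^ M n) λ ys → from (⊨-∀̇^ M n) λ xs →
        from (⊨-chain (lefts n) (rights n)) λ xs≈ys → h xs ys (subst id (eq xs ys) xs≈ys))
      where
      eq : ∀ xs ys → Pointwise _≈_ (evals M (prepend xs (prepend ys ρ)) (lefts n))
                                   (evals M (prepend xs (prepend ys ρ)) (rights n)) ≡
                     Pointwise _≈_ xs ys
      eq xs ys = cong₂ (Pointwise _≈_) (evals-lefts xs ys) (evals-rights xs ys)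

    ⊨-funCongruence : ∀ g {ρ} → _⊨_ M ρ (funCongruence g) ⇔
                      (∀ xs ys → Pointwise _≈_ xs ys → funᴹ g xs ≈ funᴹ g ys)
    ⊨-funCongruence g = mk⇔
      (λ h xs ys xs≈ys → subst id (eq xs ys) (to (⊨-∀≈̇ _) h xs ys xs≈ys))
      (λ h → from (⊨-∀≈̇ _) λ xs ys xs≈ys → subst id (sym (eq xs ys)) (h xs ys xs≈ys))
      where
      eq : ∀ {ρ} xs ys → _⊨_ M (prepend xs (prepend ys ρ)) (app g (lefts _) ≈̇ app g (rights _)) ≡
                         (funᴹ g xs ≈ funᴹ g ys)
      eq xs ys = trans (⊨-≈̇ (app g (lefts _)) (app g (rights _)))
        (cong₂ (λ v w → funᴹ g v ≈ funᴹ g w) (evals-lefts xs ys) (evals-rights xs ys))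

    ⊨-relCongruence : ∀ P {ρ} → _⊨_ M ρ (relCongruence P) ⇔
                      (∀ xs ys → Pointwise _≈_ xs ys → relᴹ P xs → relᴹ P ys)
    ⊨-relCongruence P = mk⇔
      (λ h xs ys xs≈ys → subst id (eq xs ys) (to (⊨-∀≈̇ _) h xs ys xs≈ys))
      (λ h → from (⊨-∀≈̇ _) λ xs ys xs≈ys → subst id (sym (eq xs ys)) (h xs ys xs≈ys))
      where
      eq : ∀ {ρ} xs ys → _⊨_ M (prepend xs (prepend ys ρ)) (atom P (lefts _) →̇ atom P (rights _)) ≡
                         (relᴹ P xs → relᴹ P ys)
      eq xs ys = cong₂ (λ v w → relᴹ P v → relᴹ P w) (evals-lefts xs ys) (evals-rights xs ys)

    ⊨-reflexivity : ∀ {ρ} → _⊨_ M ρ reflexivity ⇔ Reflexive _≈_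
    ⊨-reflexivity = mk⇔
      (λ h {x} → subst id (⊨-≈̇ (var 0) (var 0)) (h x))
      (λ h x → subst id (sym (⊨-≈̇ (var 0) (var 0))) (h {x}))

    ⊨-euclideanness : ∀ {ρ} → _⊨_ M ρ euclideanness ⇔ (∀ {x y z} → x ≈ y → x ≈ z → y ≈ z)
    ⊨-euclideanness = mk⇔
      (λ h {x} {y} {z} x≈y x≈z → subst id (eq 1 0)
        (h x y z (subst id (sym (eq 2 1)) x≈y) (subst id (sym (eq 2 0)) x≈z)))
      (λ h _ _ _ x≈y x≈z →
        subst id (sym (eq 1 0)) (h (subst id (eq 2 1) x≈y) (subst id (eq 2 0) x≈z)))
      where
      eq : ∀ {ρ} m n → _⊨_ M ρ (var m ≈̇ var n) ≡ (ρ m ≈ ρ n)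
      eq m n = ⊨-≈̇ (var m) (var n)

    -- Models with true equality satisfy the axioms

    module Equality (≈⇔≡ : InterpretsAsEquality M E ar) where

      ≈-refl : Reflexive _≈_
      ≈-refl = from (≈⇔≡ _ _) refl

      ≈-euclidean : ∀ {x y z} → x ≈ y → x ≈ z → y ≈ z
      ≈-euclidean x≈y x≈z = from (≈⇔≡ _ _) (trans (sym (to (≈⇔≡ _ _) x≈y)) (to (≈⇔≡ _ _) x≈z))

      Pointwise-≈⇒≡ : {xs ys : Vec D n} → Pointwise _≈_ xs ys → xs ≡ ys
      Pointwise-≈⇒≡ = Pointwise-≡⇒≡ ∘ Pointwise.map (to (≈⇔≡ _ _))

      -- Related argument vectors are equal here, so each congruence axiom is an instance of
      -- substitution.
      ⊨-congruenceᵗ  : ∀ {ρ} t → _⊨_ M ρ (congruenceᵗ t)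
      ⊨-congruenceᵗˢ : ∀ {ρ} (ts : Vec (Term S) n) → _⊨_ M ρ (congruenceᵗˢ ts)

      ⊨-congruenceᵗ (var _)    = id
      ⊨-congruenceᵗ (app g ts) =
        from (⊨-funCongruence g) (λ _ _ xs≈ys →
          subst (λ zs → funᴹ g _ ≈ funᴹ g zs) (Pointwise-≈⇒≡ xs≈ys) ≈-refl) ,
        ⊨-congruenceᵗˢ ts

      ⊨-congruenceᵗˢ []       = id
      ⊨-congruenceᵗˢ (t ∷ ts) = ⊨-congruenceᵗ t , ⊨-congruenceᵗˢ ts

      ⊨-congruence : ∀ {ρ} φ → _⊨_ M ρ (congruence φ)
      ⊨-congruence ⊥̇           = id
      ⊨-congruence (atom P ts) =
        from (⊨-relCongruence P) (λ _ _ xs≈ys → subst (relᴹ P) (Pointwise-≈⇒≡ xs≈ys)) ,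
        ⊨-congruenceᵗˢ ts
      ⊨-congruence (φ →̇ ψ)     = ⊨-congruence φ , ⊨-congruence ψ
      ⊨-congruence (φ ∧̇ ψ)     = ⊨-congruence φ , ⊨-congruence ψ
      ⊨-congruence (φ ∨̇ ψ)     = ⊨-congruence φ , ⊨-congruence ψ
      ⊨-congruence (∀̇ φ)       = ⊨-congruence φ
      ⊨-congruence (∃̇ φ)       = ⊨-congruence φ

    -- The quotient model

    module Quotient
      (≈-refl : Reflexive _≈_) (≈-euclidean : ∀ {x y z} → x ≈ y → x ≈ z → y ≈ z)
      (finite : Finite D) (decidable : DecidableModel M) where

      ≈-sym : Symmetric _≈_
      ≈-sym x≈y = ≈-euclidean x≈y ≈-refl

      ≈-trans : Transitive _≈_
      ≈-trans = ≈-euclidean ∘ ≈-sym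

      ≈-decSetoid : DecSetoid ℓ ℓ
      ≈-decSetoid = record
        { _≈_              = _≈_
        ; isDecEquivalence = record
          { isEquivalence = record { refl = ≈-refl ; sym = ≈-sym ; trans = ≈-trans }
          ; _≟_           = λ _ _ → decidable E _
          }
        }

      open Representatives (representatives ≈-decSetoid finite) public

      -- `Lift` moves `Fin size` from the lowest universe to the level required of domains.
      D/≈ : Set ℓ
      D/≈ = Lift ℓ (Fin size)

      [_] : D → D/≈
      [ x ] = lift (class x)

      repr : D/≈ → D
      repr = rep ∘ lower

      M/≈ : Model S D/≈
      M/≈ = record
        { funᴹ = λ g xs → [ funᴹ g (map repr xs) ]
        ; relᴹ = λ P xs → relᴹ P (map repr xs)
        }

      D/≈-finite : Finite D/≈
      D/≈-finite = List.map lift (List.allFin size) , λ i → ∈-map⁺ lift (∈-allFin (lower i))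

      M/≈-decidable : DecidableModel M/≈
      M/≈-decidable P xs = decidable P (map repr xs)

      map-subst : ∀ {m n} (m≡n : m ≡ n) (xs : Vec D/≈ m) →
                  map repr (subst (Vec D/≈) m≡n xs) ≡ subst (Vec D) m≡n (map repr xs)
      map-subst refl xs = refl

      -- Distinct classes have inequivalent representatives, so `E` collapses to identity.
      M/≈-equality : InterpretsAsEquality M/≈ E ar
      M/≈-equality x y = mk⇔
        (λ x≈y → cong lift (rep-injects _ _ (subst (relᴹ E) (map-subst (sym ar) _) x≈y)))
        (λ { refl → subst (relᴹ E) (sym (map-subst (sym ar) _)) ≈-refl })

      -- Relating values up to `≈` lets a quantifier extend both assignments from either side: by
      -- `x` and `[ x ]`, or by `repr x′` and `x′`.
      _∼_ : (ℕ → D) → (ℕ → D/≈) → Set ℓ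
      ρ ∼ ρ′ = ∀ n → ρ n ≈ repr (ρ′ n)

      •-cong : ∀ {x x′ ρ ρ′} → x ≈ repr x′ → ρ ∼ ρ′ → (x • ρ) ∼ (x′ • ρ′)
      •-cong x≈ ρ∼ zero    = x≈
      •-cong x≈ ρ∼ (suc n) = ρ∼ n

      -- The congruence axioms are closed, so they are assumed at one assignment ρ₀
      -- while ρ varies under the quantifiers.
      module _ {ρ₀ : ℕ → D} where

        eval-≈  : ∀ {ρ ρ′} → ρ ∼ ρ′ → ∀ t → _⊨_ M ρ₀ (congruenceᵗ t) →
                  eval M ρ t ≈ repr (eval M/≈ ρ′ t)
        evals-≈ : ∀ {ρ ρ′} → ρ ∼ ρ′ → (ts : Vec (Term S) n) → _⊨_ M ρ₀ (congruenceᵗˢ ts) →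
                  Pointwise _≈_ (evals M ρ ts) (map repr (evals M/≈ ρ′ ts))

        eval-≈ ρ∼ (var n)    _         = ρ∼ n
        eval-≈ ρ∼ (app g ts) (cg , cs) =
          -- Congruence replaces the arguments by representatives; `rep-class` then replaces the
          -- value by the representative of its class.
          ≈-trans (to (⊨-funCongruence g) cg _ _ (evals-≈ ρ∼ ts cs)) (rep-class _)

        evals-≈ ρ∼ []       _        = []
        evals-≈ ρ∼ (t ∷ ts) (c , cs) = eval-≈ ρ∼ t c ∷ evals-≈ ρ∼ ts cs

        -- Both directions are proved together because the premise of an implication is
        -- contravariant.
        ⊨-quotient : ∀ {ρ ρ′} → ρ ∼ ρ′ → ∀ φ → _⊨_ M ρ₀ (congruence φ) →
                     _⊨_ M ρ φ ⇔ _⊨_ M/≈ ρ′ φ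
        ⊨-quotient ρ∼ ⊥̇           _         = mk⇔ ⊥-elim ⊥-elim
        ⊨-quotient ρ∼ (atom P ts) (cP , cs) = mk⇔
          (to (⊨-relCongruence P) cP _ _ ts≈)
          (to (⊨-relCongruence P) cP _ _ (Pointwise.sym ≈-sym ts≈))
          where ts≈ = evals-≈ ρ∼ ts cs
        ⊨-quotient ρ∼ (φ →̇ ψ) (c , d) = →-cong-⇔ (⊨-quotient ρ∼ φ c) (⊨-quotient ρ∼ ψ d)
        ⊨-quotient ρ∼ (φ ∧̇ ψ) (c , d) = ⊨-quotient ρ∼ φ c ×-⇔ ⊨-quotient ρ∼ ψ d
        ⊨-quotient ρ∼ (φ ∨̇ ψ) (c , d) = ⊨-quotient ρ∼ φ c ⊎-⇔ ⊨-quotient ρ∼ ψ d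
        ⊨-quotient ρ∼ (∀̇ φ)   c       = mk⇔
          (λ h x′ → to   (⊨-quotient (•-cong ≈-refl ρ∼) φ c) (h (repr x′)))
          (λ h x  → from (⊨-quotient (•-cong (rep-class x) ρ∼) φ c) (h [ x ]))
        ⊨-quotient ρ∼ (∃̇ φ)   c       = mk⇔
          (λ (x  , h) → [ x ]   , to   (⊨-quotient (•-cong (rep-class x) ρ∼) φ c) h)
          (λ (x′ , h) → repr x′ , from (⊨-quotient (•-cong ≈-refl ρ∼) φ c) h)

-- The reduction

theorem21 : ∀ {f r : Level} (ℓ : Level) (S : Signature f r) (E : Rel S) (ar : relAr S E ≡ 2) →
    FSATEQ ℓ S E ar ⪯ FSAT ℓ S
theorem21 ℓ S E ar = equalityFree S E ar , λ φ → mk⇔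
  (λ (D , M , ρ , finite , decidable , equality , ⊨φ) →
    let open Equality S E ar M equality in
    -- The model itself is kept, since it already satisfies the added axioms.
    D , M , ρ , finite , decidable ,
    ⊨φ , from (⊨-reflexivity S E ar M) ≈-refl
       , from (⊨-euclideanness S E ar M) ≈-euclidean
       , ⊨-congruence φ)
  (λ (D , M , ρ , finite , decidable , ⊨φ , ⊨refl , ⊨eucl , ⊨cong) →
    let open Quotient S E ar M (to (⊨-reflexivity S E ar M) ⊨refl)
                               (to (⊨-euclideanness S E ar M) ⊨eucl) finite decidable in
    D/≈ , M/≈ , [_] ∘ ρ , D/≈-finite , M/≈-decidable , M/≈-equality ,
    to (⊨-quotient (λ n → rep-class (ρ n)) φ ⊨cong) ⊨φ)
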